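{- Let $\mathcal G,\mathcal G'$ be two parity games with vertex sets $V,V'$, let $\approx$ denote governed bisimilarity, and let $\mathcal G_q=(V_{/\approx},\to_q,\Omega_q,\mathcal P_q)$ and $\mathcal G'_q=(V'_{/\approx},\to'_q,\Omega'_q,\mathcal P'_q)$ be their governed bisimulation quotients, respectively. Then $\mathcal G\approx\mathcal G'$ if and only if the two structures $\mathcal G_q$ and $\mathcal G'_q$ are isomorphic.
   Context: A parity game is a tuple $(V,\to,\Omega,\mathcal P)$ where $V$ is a finite set of vertices, $\to\subseteq V\times V$ is total (every vertex has at least one successor), $\Omega:V\to\mathbb N$ is a priority function, and $\mathcal P:V\to\{\Diamond,\Box\}$ assigns each vertex to player even ($\Diamond$) or odd ($\Box$). Write $V_\Diamond,V_\Box$ for the vertices owned by each player and $v^\bullet=\{w\mid v\to w\}$. A symmetric relation $R\subseteq V\times V$ is a governed bisimulation iff $v\,R\,w$ implies: (1) $\Omega(v)=\Omega(w)$; (2) if $\mathcal P(v)\neq\mathcal P(w)$, then $v'\,R\,w'$ for all $v'\in v^\bullet$ and $w'\in w^\bullet$; (3) for all $v'\in v^\bullet$ there is some $w'\in w^\bullet$ with $v'\,R\,w'$. Governed bisimilarity: $v\approx w$ iff some governed bisimulation $R$ has $v\,R\,w$ (this is an equivalence relation). $V_{/\approx}$ is the set of its classes and $[V'']_\approx=\{[v]_\approx\mid v\in V''\}$ for $V''\subseteq V$. Governed bisimulation quotient of $(V,\to,\Omega,\mathcal P)$: the structure $(V_{/\approx},\to_q,\Omega_q,\mathcal P_q)$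 with, for classes $\mathcal C,\mathcal C'$: - $\Omega_q(\mathcal C)=\min\{\Omega(v)\mid v\in\mathcal C\}$; - $\mathcal P_q(\mathcal C)=\Box$ if $\mathcal C\subseteq V_\Box$ and $|[u^\bullet]_\approx|>1$ for all $u\in\mathcal C$; $\mathcal P_q(\mathcal C)=\Diamond$ otherwise; - $\mathcal C\to_q\mathcal C'$ iff for all $v\in\mathcal C$ there is $v'\in v^\bullet$ with $v'\in\mathcal C'$. Equivalence of games: for parity games $\mathcal G_1,\mathcal G_2$ with vertex sets $V_1,V_2$ and a vertex equivalence $\sim$, $\mathcal G_1\sim\mathcal G_2$ iff in the disjoint union of $\mathcal G_1$ and $\mathcal G_2$, every $v_1\in V_1$ has some $v_2\in V_2$ with $v_1\sim v_2$, and every $v_2\in V_2$ has some $v_1\in V_1$ with $v_1\sim v_2$. Two such structures are isomorphic iff there is a bijection between their vertex sets that preserves priorities and owners, and preserves and reflects edges. -}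

module Defs where

open import Data.Bool.Base using (if_then_else_)
open import Data.Empty using (⊥-elim)
open import Data.Fin.Base using (Fin)
import Data.Fin.Properties as Fin
open import Data.List.Base using (List; length; map; filter; deduplicate; allFin; cartesianProduct)
open import Data.List.Extrema.Nat using (min; v≤min⁺; min≤⊤)
open import Data.List.Membership.Propositional using (_∈_)
open import Data.List.Membership.Propositional.Properties
  using (∈-map⁺; ∈-allFin; ∈-cartesianProduct⁺; ∈-filter⁺)
open import Data.List.Properties using (filter-notAll)
open import Data.List.Relation.Unary.All as All using (All)
import Data.List.Relation.Unary.All.Properties as All
import Data.List.Relation.Unary.Any as Any
open import Data.Nat.Base using (ℕ; _<_)
import Data.Nat.Properties as ℕ
open import Data.Nat.Induction using (Acc; acc; <-wellFounded)
open import Data.Product.Base using (Σ-syntax; ∃; ∃-syntax; _×_; _,_; proj₁; proj₂)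
open import Data.Product.Properties using (≡-dec)
open import Data.Sum.Base using (_⊎_; inj₁; inj₂; [_,_])
open import Data.Sum.Function.Propositional using (_⊎-↔_)
open import Data.Sum.Relation.Binary.Pointwise using (Pointwise; inj₁; inj₂; ⊎-decidable)
open import Function.Base using (_∘_)
open import Function.Bundles using (_↔_; _⇔_; mk⇔; Inverse; Bijection)
open import Function.Construct.Composition using (_↔-∘_)
open import Function.Construct.Symmetry using (↔-sym)
open import Function.Properties.Inverse using (↔⇒↣)
open import Level using (Level; 0ℓ; _⊔_) renaming (suc to lsuc)
open import Relation.Binary.Bundles using (Setoid)
open import Relation.Binary.Core using (Rel)
open import Relation.Binary.Definitions
  using (Symmetric; Decidable; DecidableEquality)
open import Relation.Binary.Structures using (IsEquivalence)
open import Relation.Binary.PropositionalEquality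
  using (_≡_; _≢_; refl; sym; trans; cong; subst)
open import Relation.Nullary.Decidable
  using (Dec; yes; no; does; ¬?; _×-dec_; _→-dec_; map′; does-⇔)
import Relation.Unary as U

private
  variable
    ℓ : Level

data Player : Set where
  ◇ □ : Player

_≟ᴾ_ : DecidableEquality Player
◇ ≟ᴾ ◇ = yes refl
◇ ≟ᴾ □ = no λ()
□ ≟ᴾ ◇ = no λ()
□ ≟ᴾ □ = yes refl

-- Decidability of edges is implicit in the classical reading of a subset
-- of the finite set V × V.
record ParityGame : Set₁ where
  infix 4 _⟶_ _⟶?_
  field
    V      : Set
    finite : ∃[ n ] (V ↔ Fin n)
    _⟶_    : Rel V 0ℓ
    _⟶?_   : Decidable _⟶_
    total  : ∀ v → ∃[ w ] v ⟶ w
    Ω      : V → ℕ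
    𝓟      : V → Player

  private
    module F = Inverse (proj₂ finite)

  vertices : List V
  vertices = map F.from (allFin (proj₁ finite))

  ∈-vertices : ∀ v → v ∈ vertices
  ∈-vertices v = subst (_∈ vertices) (F.strictlyInverseʳ v) (∈-map⁺ F.from (∈-allFin (F.to v)))

  _≟ⱽ_ : DecidableEquality V
  _≟ⱽ_ = Fin.inj⇒≟ (↔⇒↣ (proj₂ finite))

  _• : V → List V
  v • = filter (v ⟶?_) vertices

  ∀? : {P : V → Set ℓ} → U.Decidable P → Dec (∀ v → P v)
  ∀? P? = map′ (λ ps v → All.lookup ps (∈-vertices v)) (λ p → All.tabulate (λ {v} _ → p v))
            (All.all? P? vertices)

  ∃? : {P : V → Set ℓ} → U.Decidable P → Dec (∃ P)
  ∃? P? = map′ Any.satisfied (λ (v , p) → Any.map (λ { refl → p }) (∈-vertices v))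
            (Any.any? P? vertices)

module _ (G : ParityGame) where
  open ParityGame G

  record IsGovernedBisimulation (R : Rel V ℓ) : Set ℓ where
    field
      symmetric : Symmetric R
      priority  : ∀ {v w} → R v w → Ω v ≡ Ω w
      owner     : ∀ {v w} → R v w → 𝓟 v ≢ 𝓟 w →
                  ∀ v′ w′ → v ⟶ v′ → w ⟶ w′ → R v′ w′
      transfer  : ∀ {v w} → R v w → ∀ v′ → v ⟶ v′ → ∃[ w′ ] (w ⟶ w′ × R v′ w′)

  GovernedBisimilar : Rel V (lsuc 0ℓ)
  GovernedBisimilar v w = Σ[ R ∈ Rel V 0ℓ ] (IsGovernedBisimulation R × R v w)

module GovernedBisimilarity (G : ParityGame) where
  open ParityGame G

  infix 4 _≈_ _≈?_
  _≈_ : Rel V (lsuc 0ℓ)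
  _≈_ = GovernedBisimilar G

  private
    open module B {ℓ} {R : Rel V ℓ} (b : IsGovernedBisimulation G R) =
      IsGovernedBisimulation b

    Comp : Rel V 0ℓ → Rel V 0ℓ → Rel V 0ℓ
    Comp R S v u = ∃[ w ] (R v w × S w u)

    comp-owner : ∀ {R S} → IsGovernedBisimulation G R → IsGovernedBisimulation G S →
                 ∀ {v u} → Comp R S v u → 𝓟 v ≢ 𝓟 u →
                 ∀ v′ u′ → v ⟶ v′ → u ⟶ u′ → Comp R S v′ u′
    comp-owner r s {v} {u} (w , vRw , wSu) v≢u v′ u′ v→v′ u→u′ with 𝓟 v ≟ᴾ 𝓟 w
    ... | no v≢w with transfer s (symmetric s wSu) u′ u→u′
    ...   | w′ , w→w′ , u′Sw′ =
      w′ , owner r vRw v≢w v′ w′ v→v′ w→w′ , symmetric s u′Sw′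
    comp-owner r s {v} {u} (w , vRw , wSu) v≢u v′ u′ v→v′ u→u′ | yes v≡w
      with transfer r vRw v′ v→v′
    ...   | w′ , w→w′ , v′Rw′ =
      w′ , v′Rw′ , owner s wSu (v≢u ∘ trans v≡w) w′ u′ w→w′ u→u′

    comp-transfer : ∀ {R S} → IsGovernedBisimulation G R → IsGovernedBisimulation G S →
                    ∀ {v u} → Comp R S v u →
                    ∀ v′ → v ⟶ v′ → ∃[ u′ ] (u ⟶ u′ × Comp R S v′ u′)
    comp-transfer r s (w , vRw , wSu) v′ v→v′ with transfer r vRw v′ v→v′
    ... | w′ , w→w′ , v′Rw′ with transfer s wSu w′ w→w′
    ...   | u′ , u→u′ , w′Su′ = u′ , u→u′ , w′ , v′Rw′ , w′Su′

    comp-sym : ∀ {R S} → IsGovernedBisimulation G R → IsGovernedBisimulation G S →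
               ∀ {v u} → Comp R S v u → Comp S R u v
    comp-sym r s (w , vRw , wSu) = w , symmetric s wSu , symmetric r vRw

    comp-bisim : ∀ {R S} → IsGovernedBisimulation G R → IsGovernedBisimulation G S →
                 IsGovernedBisimulation G (λ v u → Comp R S v u ⊎ Comp S R v u)
    comp-bisim r s = record
      { symmetric = [ inj₂ ∘ comp-sym r s , inj₁ ∘ comp-sym s r ]
      ; priority  = [ (λ (_ , p , q) → trans (priority r p) (priority s q))
                    , (λ (_ , p , q) → trans (priority s p) (priority r q)) ]
      ; owner     = [ (λ c d v′ u′ p q → inj₁ (comp-owner r s c d v′ u′ p q))
                    , (λ c d v′ u′ p q → inj₂ (comp-owner s r c d v′ u′ p q)) ]
      ; transfer  = λ where
          (inj₁ c) v′ p → let u′ , q , e = comp-transfer r s c v′ p in u′ , q , inj₁ e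
          (inj₂ c) v′ p → let u′ , q , e = comp-transfer s r c v′ p in u′ , q , inj₂ e
      }

    ≡-bisim : IsGovernedBisimulation G _≡_
    ≡-bisim = record
      { symmetric = sym
      ; priority  = cong Ω
      ; owner     = λ { refl v≢v _ _ _ _ → ⊥-elim (v≢v refl) }
      ; transfer  = λ { refl v′ v→v′ → v′ , v→v′ , refl }
      }

  ≈-isEquivalence : IsEquivalence _≈_
  ≈-isEquivalence = record
    { refl  = _≡_ , ≡-bisim , refl
    ; sym   = λ (R , r , p) → R , r , symmetric r p
    ; trans = λ (R , r , p) (S , s , q) → _ , comp-bisim r s , inj₁ (_ , p , q)
    }

  ≈⇒Ω≡ : ∀ {v w} → v ≈ w → Ω v ≡ Ω w
  ≈⇒Ω≡ (_ , r , p) = priority r p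

  -- Governed bisimilarity is decidable: starting from V × V, discard pairs
  -- violating the bisimulation conditions until the relation is stable.
  private
    _≟²_ : DecidableEquality (V × V)
    _≟²_ = ≡-dec _≟ⱽ_ _≟ⱽ_

    open import Data.List.Membership.DecPropositional _≟²_ using (_∈?_)

    Ok : List (V × V) → V × V → Set
    Ok L (v , w) =
      (w , v) ∈ L × Ω v ≡ Ω w ×
      (𝓟 v ≢ 𝓟 w → ∀ v′ w′ → v ⟶ v′ → w ⟶ w′ → (v′ , w′) ∈ L) ×
      (∀ v′ → v ⟶ v′ → ∃[ w′ ] (w ⟶ w′ × (v′ , w′) ∈ L))

    Ok? : ∀ L → U.Decidable (Ok L)
    Ok? L (v , w) =
      ((w , v) ∈? L) ×-dec (Ω v ℕ.≟ Ω w) ×-dec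
      (¬? (𝓟 v ≟ᴾ 𝓟 w) →-dec ∀? λ v′ → ∀? λ w′ →
        (v ⟶? v′) →-dec (w ⟶? w′) →-dec ((v′ , w′) ∈? L)) ×-dec
      (∀? λ v′ → (v ⟶? v′) →-dec ∃? λ w′ → (w ⟶? w′) ×-dec ((v′ , w′) ∈? L))

    Above : List (V × V) → Set₁
    Above L = ∀ {v w} → v ≈ w → (v , w) ∈ L

    above⇒Ok : ∀ {L} → Above L → ∀ {v w} → v ≈ w → Ok L (v , w)
    above⇒Ok ab (R , r , p) =
        ab (R , r , symmetric r p)
      , priority r p
      , (λ v≢w v′ w′ i j → ab (R , r , owner r p v≢w v′ w′ i j))
      , (λ v′ i → let w′ , j , q = transfer r p v′ i in w′ , j , ab (R , r , q))

    stable⇒bisim : ∀ {L} → All (Ok L) L → IsGovernedBisimulation G (λ v w → (v , w) ∈ L)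
    stable⇒bisim ok = record
      { symmetric = λ p → proj₁ (All.lookup ok p)
      ; priority  = λ p → proj₁ (proj₂ (All.lookup ok p))
      ; owner     = λ p → proj₁ (proj₂ (proj₂ (All.lookup ok p)))
      ; transfer  = λ p → proj₂ (proj₂ (proj₂ (All.lookup ok p)))
      }

    refine : ∀ L → Acc _<_ (length L) → Above L → Decidable _≈_
    refine L (acc rs) ab with All.all? (Ok? L) L
    ... | yes ok = λ v w → map′ (λ p → _ , stable⇒bisim ok , p) ab ((v , w) ∈? L)
    ... | no ¬ok = refine (filter (Ok? L) L)
                     (rs (filter-notAll (Ok? L) L (All.¬All⇒Any¬ (Ok? L) L ¬ok)))
                     (λ p → ∈-filter⁺ (Ok? L) (ab p) (above⇒Ok ab p))

  _≈?_ : Decidable _≈_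
  _≈?_ = refine (cartesianProduct vertices vertices) (<-wellFounded _)
           (λ {v} {w} _ → ∈-cartesianProduct⁺ (∈-vertices v) (∈-vertices w))

-- The vertices form a setoid so that they can be equivalence classes.
record GameStructure (a ℓ : Level) : Set (lsuc (a ⊔ ℓ)) where
  infix 4 _⟶_
  field
    vertexSetoid : Setoid a ℓ
  open Setoid vertexSetoid public using (Carrier; _≈_)
  field
    _⟶_    : Rel Carrier ℓ
    Ω      : Carrier → ℕ
    𝓟      : Carrier → Player
    ⟶-resp : ∀ {v v′ w w′} → v ≈ v′ → w ≈ w′ → v ⟶ w → v′ ⟶ w′
    Ω-cong : ∀ {v v′} → v ≈ v′ → Ω v ≡ Ω v′
    𝓟-cong : ∀ {v v′} → v ≈ v′ → 𝓟 v ≡ 𝓟 v′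

record Isomorphism {a₁ ℓ₁ a₂ ℓ₂} (A : GameStructure a₁ ℓ₁) (B : GameStructure a₂ ℓ₂) :
                   Set (a₁ ⊔ ℓ₁ ⊔ a₂ ⊔ ℓ₂) where
  private
    module A = GameStructure A
    module B = GameStructure B
  field
    bijection : Bijection A.vertexSetoid B.vertexSetoid
  open Bijection bijection public using (to)
  field
    Ω-preserved : ∀ v → A.Ω v ≡ B.Ω (to v)
    𝓟-preserved : ∀ v → A.𝓟 v ≡ B.𝓟 (to v)
    ⟶-preserved : ∀ v w → (v A.⟶ w) ⇔ (to v B.⟶ to w)

-- A class 𝓒 is given by any of its members v; membership of w in 𝓒 is v ≈ w.
module Quotient (G : ParityGame) where
  open ParityGame G
  open GovernedBisimilarity G
  private
    module ≈ = IsEquivalence ≈-isEquivalence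

  [_] : V → V → Set₁
  [ v ] = v ≈_

  members : V → List V
  members v = filter (v ≈?_) vertices

  -- The cardinality |[V″]≈|, for V″ given by an enumeration.
  ∣[_]≈∣ : List V → ℕ
  ∣[ V″ ]≈∣ = length (deduplicate _≈?_ V″)

  -- The first argument of min is a default value; v itself belongs to [ v ].
  Ω-q : V → ℕ
  Ω-q v = min (Ω v) (map Ω (members v))

  OddClass : V → Set₁
  OddClass v = (∀ u → u U.∈ [ v ] → 𝓟 u ≡ □) × (∀ u → u U.∈ [ v ] → 1 < ∣[ u • ]≈∣)

  OddClass? : U.Decidable OddClass
  OddClass? v = (∀? λ u → (v ≈? u) →-dec (𝓟 u ≟ᴾ □))
          ×-dec (∀? λ u → (v ≈? u) →-dec (1 ℕ.<? ∣[ u • ]≈∣))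

  𝓟-q : V → Player
  𝓟-q v = if does (OddClass? v) then □ else ◇

  infix 4 _⟶q_
  _⟶q_ : Rel V (lsuc 0ℓ)
  c ⟶q c′ = ∀ v → v U.∈ [ c ] → ∃[ v′ ] (v ⟶ v′ × v′ U.∈ [ c′ ])

  private
    Ω-q≡Ω : ∀ v → Ω-q v ≡ Ω v
    Ω-q≡Ω v = ℕ.≤-antisym (min≤⊤ (Ω v) (map Ω (members v)))
      (v≤min⁺ ℕ.≤-refl (All.map⁺ (All.map (ℕ.≤-reflexive ∘ ≈⇒Ω≡) (All.all-filter (v ≈?_) vertices))))

    OddClass-resp : ∀ {v w} → v ≈ w → OddClass v → OddClass w
    OddClass-resp v≈w (odd , many) =
        (λ u w≈u → odd u (≈.trans v≈w w≈u))
      , (λ u w≈u → many u (≈.trans v≈w w≈u))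

  quotient : GameStructure 0ℓ (lsuc 0ℓ)
  quotient = record
    { vertexSetoid = record { isEquivalence = ≈-isEquivalence }
    ; _⟶_    = _⟶q_
    ; Ω      = Ω-q
    ; 𝓟      = 𝓟-q
    ; ⟶-resp = λ v≈v′ w≈w′ v⟶w u v′≈u →
        let u′ , u→u′ , w≈u′ = v⟶w u (≈.trans v≈v′ v′≈u)
        in u′ , u→u′ , ≈.trans (≈.sym w≈w′) w≈u′
    ; Ω-cong = λ {v} {w} v≈w → trans (Ω-q≡Ω v) (trans (≈⇒Ω≡ v≈w) (sym (Ω-q≡Ω w)))
    ; 𝓟-cong = λ {v} {w} v≈w → cong (if_then □ else ◇)
        (does-⇔ (mk⇔ (OddClass-resp v≈w) (OddClass-resp (≈.sym v≈w)))
          (OddClass? v) (OddClass? w))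
    }

open Quotient public using (quotient)

_⊎ᴳ_ : ParityGame → ParityGame → ParityGame
G₁ ⊎ᴳ G₂ = record
  { V      = G₁.V ⊎ G₂.V
  ; finite = _ , ↔-sym Fin.+↔⊎ ↔-∘ (proj₂ G₁.finite ⊎-↔ proj₂ G₂.finite)
  ; _⟶_    = Pointwise G₁._⟶_ G₂._⟶_
  ; _⟶?_   = ⊎-decidable G₁._⟶?_ G₂._⟶?_
  ; total  = λ where
      (inj₁ v) → let w , p = G₁.total v in inj₁ w , inj₁ p
      (inj₂ v) → let w , p = G₂.total v in inj₂ w , inj₂ p
  ; Ω      = [ G₁.Ω , G₂.Ω ]
  ; 𝓟      = [ G₁.𝓟 , G₂.𝓟 ]
  }
  where
  module G₁ = ParityGame G₁
  module G₂ = ParityGame G₂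

-- The vertex equivalence must be given for every game, since it is compared in
-- the disjoint union.
GameEquivalence : ((G : ParityGame) → Rel (ParityGame.V G) ℓ) → Rel ParityGame ℓ
GameEquivalence vertexEquivalence G₁ G₂ =
    (∀ v₁ → ∃[ v₂ ] (inj₁ v₁ ∼ inj₂ v₂))
  × (∀ v₂ → ∃[ v₁ ] (inj₁ v₁ ∼ inj₂ v₂))
  where
  _∼_ = vertexEquivalence (G₁ ⊎ᴳ G₂)

infix 4 _≈ᴳ_
_≈ᴳ_ : Rel ParityGame (lsuc 0ℓ)
_≈ᴳ_ = GameEquivalence GovernedBisimilar

{-# OPTIONS --safe #-}
-- Call a vertex uniform if all its successors are bisimilar. Uniformity is
-- invariant under bisimilarity, and bisimilar vertices with different owners
-- are uniform, so the owner of a quotient class is ◇ if its members are uniform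
-- and their common owner otherwise.
--
-- Each summand is closed under successors in the disjoint union, hence its
-- quotient is a full substructure of the quotient of the union. If G ≈ᴳ G′, both
-- substructures are the whole quotient of the union. Conversely, for an
-- isomorphism f of the quotients, the pairs v, w with f [v] = [w] form a governed
-- bisimulation: if the owners of such v and w differ, then one of the two is
-- uniform, and the transfer condition relates all their successors.
module Submission where

open import Defs
open import Data.Bool.Base using (if_then_else_)
open import Data.List.Base using ([]; _∷_; length; map; deduplicate)
open import Data.List.Extrema.Nat using (v≤min⁺; min≤⊤)
open import Data.List.Membership.Propositional using (_∈_)
open import Data.List.Membership.Propositional.Properties using (∈-filter⁺; ∈-filter⁻)
open import Data.List.Properties using (filter-none)
open import Data.List.Relation.Unary.All as All using ()
import Data.List.Relation.Unary.All.Properties as All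
open import Data.List.Relation.Unary.Any as Any using (Any; here; there)
import Data.List.Relation.Unary.Any.Properties as Any
open import Data.Nat.Base using (_≤_; z≤n; s≤s)
import Data.Nat.Properties as ℕ
open import Data.Product.Base using (∃-syntax; _×_; _,_; proj₁; proj₂)
open import Data.Sum.Base using (inj₁; inj₂)
open import Data.Sum.Relation.Binary.Pointwise using (inj₁; inj₂)
open import Function.Base using (_∘_; _on_)
open import Function.Bundles using (_⇔_; mk⇔; Bijection; Equivalence)
open import Level using (Level; 0ℓ)
open import Relation.Binary.Core using (Rel)
open import Relation.Binary.Definitions using (Decidable)
open import Relation.Binary.Structures using (IsEquivalence)
open import Relation.Binary.PropositionalEquality
  using (_≡_; _≢_; refl; sym; trans; cong; subst; module ≡-Reasoning)
open import Relation.Nullary.Decidable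
  using (yes; no; True; toWitness; fromWitness; dec-true; dec-false; decidable-stable; _→-dec_)
open import Relation.Nullary.Negation using (¬_; contradiction)
import Relation.Unary as U

private
  variable
    a ℓ : Level

-- Counting classes in a finite enumeration.

module _ {A : Set a} {_∼_ : Rel A ℓ} (∼-eq : IsEquivalence _∼_) (_∼?_ : Decidable _∼_) where
  private
    module ∼ = IsEquivalence ∼-eq

  -- `deduplicate` keeps the head and filters out what is equivalent to it, here the whole
  -- deduplicated tail.
  length-deduplicate≤1 : ∀ {xs} → (∀ {x y} → x ∈ xs → y ∈ xs → x ∼ y) →
                         length (deduplicate _∼?_ xs) ≤ 1
  length-deduplicate≤1 {[]}     _   = z≤n
  length-deduplicate≤1 {x ∷ xs} all = s≤s (ℕ.≤-reflexive (cong length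
    (filter-none _ (All.map (λ x∼y x≁y → x≁y x∼y)
      (All.deduplicate⁺ _∼?_ (All.tabulate (all (here refl) ∘ there)))))))

  -- Every element of `xs` is equivalent to one that survives deduplication, and only one survives.
  length-deduplicate≤1⁻ : ∀ {xs x y} → length (deduplicate _∼?_ xs) ≤ 1 →
                          x ∈ xs → y ∈ xs → x ∼ y
  length-deduplicate≤1⁻ {xs} ≤1 x∈ y∈ =
    go ≤1 (representative x∈) (representative y∈)
    where
    representative : ∀ {x} → x ∈ xs → Any (x ∼_) (deduplicate _∼?_ xs)
    representative x∈ = Any.deduplicate⁺ _∼?_ (λ z∼y x∼y → ∼.trans x∼y (∼.sym z∼y))
                          (Any.map ∼.reflexive x∈)

    go : ∀ {ys x y} → length ys ≤ 1 → Any (x ∼_) ys → Any (y ∼_) ys → x ∼ y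
    go {_ ∷ []} _ (here x∼z) (here y∼z) = ∼.trans x∼z (∼.sym y∼z)
    go {_ ∷ _ ∷ _} (s≤s ())

-- Priorities, edges and owners of quotient classes, read off one member.

module QuotientProperties (G : ParityGame) where
  open ParityGame G
  open GovernedBisimilarity G
  open Quotient G
  module ≈ = IsEquivalence ≈-isEquivalence

  -- Each condition holds for the relation witnessing the given pair, and that relation is contained
  -- in `_≈_`.
  ≈-isBisimulation : IsGovernedBisimulation G _≈_
  ≈-isBisimulation = record
    { symmetric = ≈.sym
    ; priority  = ≈⇒Ω≡
    ; owner     = λ (R , r , p) v≢w v′ w′ i j → R , r , IsGovernedBisimulation.owner r p v≢w v′ w′ i j
    ; transfer  = λ (R , r , p) v′ i →
        let w′ , j , q = IsGovernedBisimulation.transfer r p v′ i in w′ , j , R , r , q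
    }

  open IsGovernedBisimulation ≈-isBisimulation public

  Ω-q≡Ω : ∀ v → Ω-q v ≡ Ω v
  Ω-q≡Ω v = ℕ.≤-antisym (min≤⊤ (Ω v) (map Ω (members v)))
    (v≤min⁺ ℕ.≤-refl (All.map⁺ (All.map (ℕ.≤-reflexive ∘ ≈⇒Ω≡) (All.all-filter (v ≈?_) vertices))))

  -- A quotient edge asks for a move from every member of the class; `transfer` supplies them all
  -- from a single one.
  ⟶⇒⟶q : ∀ {v w w′} → v ⟶ w → w ≈ w′ → v ⟶q w′
  ⟶⇒⟶q {w = w} v⟶w w≈w′ u v≈u =
    let u′ , u⟶u′ , w≈u′ = transfer v≈u w v⟶w
    in u′ , u⟶u′ , ≈.trans (≈.sym w≈w′) w≈u′

  Uniform : V → Set₁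
  Uniform v = ∀ {v′ v″} → v ⟶ v′ → v ⟶ v″ → v′ ≈ v″

  Uniform? : U.Decidable Uniform
  Uniform? v with ∀? (λ v′ → ∀? λ v″ → (v ⟶? v′) →-dec (v ⟶? v″) →-dec (v′ ≈? v″))
  ... | yes u = yes (u _ _)
  ... | no ¬u = no λ u → ¬u λ _ _ → u

  Uniform-resp : ∀ {v w} → v ≈ w → Uniform v → Uniform w
  Uniform-resp v≈w uni {w′} {w″} i j =
    let v′ , i′ , w′≈v′ = transfer (≈.sym v≈w) w′ i
        v″ , j′ , w″≈v″ = transfer (≈.sym v≈w) w″ j
    in ≈.trans w′≈v′ (≈.trans (uni i′ j′) (≈.sym w″≈v″))

  -- By totality `w` has a successor, and the owner condition makes every successor of `v` bisimilar
  -- to it.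
  differentOwner⇒Uniform : ∀ {v w} → v ≈ w → 𝓟 v ≢ 𝓟 w → Uniform v
  differentOwner⇒Uniform {w = w} v≈w v≢w i j =
    let w′ , k = total w
    in ≈.trans (owner v≈w v≢w _ w′ i k) (≈.sym (owner v≈w v≢w _ w′ j k))

  Uniform⇒≤1 : ∀ {v} → Uniform v → ∣[ v • ]≈∣ ≤ 1
  Uniform⇒≤1 {v} uni = length-deduplicate≤1 ≈-isEquivalence _≈?_ λ i j →
    uni (proj₂ (∈-filter⁻ (v ⟶?_) {xs = vertices} i)) (proj₂ (∈-filter⁻ (v ⟶?_) {xs = vertices} j))

  ≤1⇒Uniform : ∀ {v} → ∣[ v • ]≈∣ ≤ 1 → Uniform v
  ≤1⇒Uniform {v} ≤1 i j = length-deduplicate≤1⁻ ≈-isEquivalence _≈?_ ≤1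
    (∈-filter⁺ (v ⟶?_) (∈-vertices _) i) (∈-filter⁺ (v ⟶?_) (∈-vertices _) j)

  Uniform⇒𝓟-q≡◇ : ∀ {v} → Uniform v → 𝓟-q v ≡ ◇
  Uniform⇒𝓟-q≡◇ {v} uni = cong (if_then □ else ◇)
    (dec-false (OddClass? v) λ (_ , many) → ℕ.<⇒≱ (many v ≈.refl) (Uniform⇒≤1 uni))

  -- If `v` belongs to ◇, it is itself a member violating `OddClass`. If it belongs to □, a member
  -- with another owner would make `v` uniform, and so would a member with at most one successor
  -- class.
  ¬Uniform⇒𝓟-q≡𝓟 : ∀ {v} → ¬ Uniform v → 𝓟-q v ≡ 𝓟 v
  ¬Uniform⇒𝓟-q≡𝓟 {v} ¬uni with 𝓟 v in 𝓟v
  ... | ◇ = cong (if_then □ else ◇)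
    (dec-false (OddClass? v) λ (odd , _) → contradiction (trans (sym 𝓟v) (odd v ≈.refl)) λ())
  ... | □ = cong (if_then □ else ◇) (dec-true (OddClass? v)
    ( (λ u v≈u → trans (sym (decidable-stable (𝓟 v ≟ᴾ 𝓟 u) λ v≢u → ¬uni (differentOwner⇒Uniform v≈u v≢u))) 𝓟v)
    , (λ u v≈u → ℕ.≰⇒> λ ≤1 → ¬uni (Uniform-resp (≈.sym v≈u) (≤1⇒Uniform ≤1))) ))

-- Embeddings closed under successors.

-- Not required to be injective; it plays the role of inj₁ and inj₂.
record ClosedEmbedding (G H : ParityGame) : Set where
  private
    module G = ParityGame G
    module H = ParityGame H
  field
    embed   : G.V → H.V
    Ω-embed : ∀ v → H.Ω (embed v) ≡ G.Ω v
    𝓟-embed : ∀ v → H.𝓟 (embed v) ≡ G.𝓟 v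
    ⟶⁺      : ∀ {v w} → v G.⟶ w → embed v H.⟶ embed w
    ⟶⁻      : ∀ {v x} → embed v H.⟶ x → ∃[ w ] (v G.⟶ w × x ≡ embed w)

module ClosedEmbeddingProperties {G H : ParityGame} (e : ClosedEmbedding G H) where
  private
    module G where
      open ParityGame G public
      open GovernedBisimilarity G public
      open Quotient G public
      open QuotientProperties G public
    module H where
      open ParityGame H public
      open GovernedBisimilarity H public
      open Quotient H public
      open QuotientProperties H public
  open ClosedEmbedding e

  module _ {R : Rel G.V 0ℓ} (r : IsGovernedBisimulation G R) where
    open IsGovernedBisimulation r

    data Image : Rel H.V 0ℓ where
      image : ∀ {v w} → R v w → Image (embed v) (embed w)

    -- By `⟶⁻`, every move of an embedded vertex is the image of a move in `G`, to which `R` already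
    -- has an answer.
    image-isBisimulation : IsGovernedBisimulation H Image
    image-isBisimulation = record
      { symmetric = λ { (image p) → image (symmetric p) }
      ; priority  = λ { (image p) → trans (Ω-embed _) (trans (priority p) (sym (Ω-embed _))) }
      ; owner     = image-owner
      ; transfer  = image-transfer
      }
      where
      image-owner : ∀ {x y} → Image x y → H.𝓟 x ≢ H.𝓟 y →
                    ∀ x′ y′ → x H.⟶ x′ → y H.⟶ y′ → Image x′ y′
      image-owner (image p) x≢y x′ y′ i j with ⟶⁻ i | ⟶⁻ j
      ... | v′ , i′ , refl | w′ , j′ , refl = image
        (owner p (λ v≡w → x≢y (trans (𝓟-embed _) (trans v≡w (sym (𝓟-embed _))))) v′ w′ i′ j′)

      image-transfer : ∀ {x y} → Image x y → ∀ x′ → x H.⟶ x′ → ∃[ y′ ] (y H.⟶ y′ × Image x′ y′)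
      image-transfer (image p) x′ i with ⟶⁻ i
      ... | v′ , i′ , refl = let w′ , j , q = transfer p v′ i′ in embed w′ , ⟶⁺ j , image q

  preimage-isBisimulation : ∀ {R : Rel H.V ℓ} → IsGovernedBisimulation H R →
                            IsGovernedBisimulation G (R on embed)
  preimage-isBisimulation {R = R} r = record
    { symmetric = symmetric
    ; priority  = λ p → trans (sym (Ω-embed _)) (trans (priority p) (Ω-embed _))
    ; owner     = λ p v≢w v′ w′ i j →
        owner p (λ hv≡hw → v≢w (trans (sym (𝓟-embed _)) (trans hv≡hw (𝓟-embed _)))) _ _ (⟶⁺ i) (⟶⁺ j)
    ; transfer  = λ p v′ i →
        let x , j , q = transfer p _ (⟶⁺ i)
            w′ , j′ , x≡ = ⟶⁻ j
        in w′ , j′ , subst (R (embed v′)) x≡ q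
    }
    where open IsGovernedBisimulation r

  ≈⁺ : ∀ {v w} → v G.≈ w → embed v H.≈ embed w
  ≈⁺ (_ , r , p) = Image r , image-isBisimulation r , image p

  ≈⁻ : ∀ {v w} → embed v H.≈ embed w → v G.≈ w
  ≈⁻ (_ , r , p) = _ , preimage-isBisimulation r , p

  Uniform⁺ : ∀ {v} → G.Uniform v → H.Uniform (embed v)
  Uniform⁺ uni i j with ⟶⁻ i | ⟶⁻ j
  ... | _ , i′ , refl | _ , j′ , refl = ≈⁺ (uni i′ j′)

  Uniform⁻ : ∀ {v} → H.Uniform (embed v) → G.Uniform v
  Uniform⁻ uni i j = ≈⁻ (uni (⟶⁺ i) (⟶⁺ j))

  Ω-q-embed : ∀ v → H.Ω-q (embed v) ≡ G.Ω-q v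
  Ω-q-embed v = trans (H.Ω-q≡Ω (embed v)) (trans (Ω-embed v) (sym (G.Ω-q≡Ω v)))

  -- The class of `embed v` may have members outside the image, so the classes are not compared
  -- member by member: uniformity and the owner of `v` alone settle the value.
  𝓟-q-embed : ∀ v → H.𝓟-q (embed v) ≡ G.𝓟-q v
  𝓟-q-embed v with G.Uniform? v
  ... | yes uni = trans (H.Uniform⇒𝓟-q≡◇ (Uniform⁺ uni)) (sym (G.Uniform⇒𝓟-q≡◇ uni))
  ... | no ¬uni = trans (H.¬Uniform⇒𝓟-q≡𝓟 (λ uni → ¬uni (Uniform⁻ uni)))
                    (trans (𝓟-embed v) (sym (G.¬Uniform⇒𝓟-q≡𝓟 ¬uni)))

  ⟶q⁺ : ∀ {v w} → v G.⟶q w → embed v H.⟶q embed w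
  ⟶q⁺ v⟶w = let v′ , i , w≈v′ = v⟶w _ G.≈.refl in H.⟶⇒⟶q (⟶⁺ i) (≈⁺ (G.≈.sym w≈v′))

  ⟶q⁻ : ∀ {v w} → embed v H.⟶q embed w → v G.⟶q w
  ⟶q⁻ v⟶w with v⟶w _ H.≈.refl
  ... | x , i , w≈x with ⟶⁻ i
  ...   | v′ , i′ , refl = G.⟶⇒⟶q i′ (≈⁻ (H.≈.sym w≈x))

-- Comparing two games inside their disjoint union.

module _ (G G′ : ParityGame) where
  private
    module G where
      open ParityGame G public
      open GovernedBisimilarity G public
      open Quotient G public hiding (quotient)
      open QuotientProperties G public
    module G′ where
      open ParityGame G′ public
      open GovernedBisimilarity G′ public
      open Quotient G′ public hiding (quotient)
      open QuotientProperties G′ public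
    module ⊎ where
      open ParityGame (G ⊎ᴳ G′) public
      open GovernedBisimilarity (G ⊎ᴳ G′) public
      open QuotientProperties (G ⊎ᴳ G′) public
    module Q = GameStructure (quotient (G ⊎ᴳ G′))

  inj₁-embedding : ClosedEmbedding G (G ⊎ᴳ G′)
  inj₁-embedding = record
    { embed = inj₁ ; Ω-embed = λ _ → refl ; 𝓟-embed = λ _ → refl
    ; ⟶⁺ = inj₁ ; ⟶⁻ = λ { (inj₁ i) → _ , i , refl } }

  inj₂-embedding : ClosedEmbedding G′ (G ⊎ᴳ G′)
  inj₂-embedding = record
    { embed = inj₂ ; Ω-embed = λ _ → refl ; 𝓟-embed = λ _ → refl
    ; ⟶⁺ = inj₂ ; ⟶⁻ = λ { (inj₂ i) → _ , i , refl } }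

  private
    module ι₁ = ClosedEmbeddingProperties inj₁-embedding
    module ι₂ = ClosedEmbeddingProperties inj₂-embedding

  -- The map `f` chooses a bisimilar partner for each vertex. Every condition is moved to the union,
  -- where `v` and `f v` lie in one class, and then pulled back to a summand.
  ≈ᴳ⇒Isomorphism : G ≈ᴳ G′ → Isomorphism (quotient G) (quotient G′)
  ≈ᴳ⇒Isomorphism (left , right) = record
    { bijection = record
      { to        = f
      ; cong      = λ {v} {w} v≈w →
          ι₂.≈⁻ (⊎.≈.trans (⊎.≈.sym (v≈f v)) (⊎.≈.trans (ι₁.≈⁺ v≈w) (v≈f w)))
      ; bijective =
          (λ {v} {w} fv≈fw →
            ι₁.≈⁻ (⊎.≈.trans (v≈f v) (⊎.≈.trans (ι₂.≈⁺ fv≈fw) (⊎.≈.sym (v≈f w)))))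
        , (λ w → proj₁ (right w) , λ {v} v≈ →
            ι₂.≈⁻ (⊎.≈.trans (⊎.≈.sym (v≈f v)) (⊎.≈.trans (ι₁.≈⁺ v≈) (proj₂ (right w)))))
      }
    ; Ω-preserved = λ v → trans (sym (ι₁.Ω-q-embed v)) (trans (Q.Ω-cong (v≈f v)) (ι₂.Ω-q-embed (f v)))
    ; 𝓟-preserved = λ v → trans (sym (ι₁.𝓟-q-embed v)) (trans (Q.𝓟-cong (v≈f v)) (ι₂.𝓟-q-embed (f v)))
    ; ⟶-preserved = λ v w → mk⇔
        (λ v⟶w → ι₂.⟶q⁻ (Q.⟶-resp (v≈f v) (v≈f w) (ι₁.⟶q⁺ v⟶w)))
        (λ fv⟶fw → ι₁.⟶q⁻ (Q.⟶-resp (⊎.≈.sym (v≈f v)) (⊎.≈.sym (v≈f w)) (ι₂.⟶q⁺ fv⟶fw)))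
    }
    where
    f : G.V → G′.V
    f v = proj₁ (left v)

    v≈f : ∀ v → inj₁ v ⊎.≈ inj₂ (f v)
    v≈f v = proj₂ (left v)

  -- From an isomorphism of quotients to a bisimulation on the union.

  module _ (iso : Isomorphism (quotient G) (quotient G′)) where
    open Isomorphism iso
    open Bijection bijection using (surjective) renaming (cong to to-cong)

    -- The move induces a quotient edge, whose image under `to` is unfolded at the member `w` of the
    -- class of `to v`.
    forth : ∀ {v w v′} → to v G′.≈ w → v G.⟶ v′ → ∃[ w′ ] (w G′.⟶ w′ × to v′ G′.≈ w′)
    forth {v} {w} {v′} fv≈w i =
      Equivalence.to (⟶-preserved v v′) (G.⟶⇒⟶q i G.≈.refl) w fv≈w

    -- Surjectivity gives a class `u` over that of `w′`; the reflected quotient edge to `u` is then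
    -- unfolded at `v`.
    back : ∀ {v w w′} → to v G′.≈ w → w G′.⟶ w′ → ∃[ v′ ] (v G.⟶ v′ × to v′ G′.≈ w′)
    back {v} {w} {w′} fv≈w j =
      let u , fu≈w′ = surjective w′
          v′ , i , u≈v′ = Equivalence.from (⟶-preserved v u)
            (GameStructure.⟶-resp (quotient G′) (G′.≈.sym fv≈w) (G′.≈.sym (fu≈w′ G.≈.refl))
              (G′.⟶⇒⟶q j G′.≈.refl))
            v G.≈.refl
      in v′ , i , fu≈w′ (G.≈.sym u≈v′)

    related-priority : ∀ {v w} → to v G′.≈ w → G.Ω v ≡ G′.Ω w
    related-priority {v} {w} fv≈w = begin
      G.Ω v         ≡⟨ G.Ω-q≡Ω v ⟨
      G.Ω-q v       ≡⟨ Ω-preserved v ⟩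
      G′.Ω-q (to v) ≡⟨ G′.Ω-q≡Ω (to v) ⟩
      G′.Ω (to v)   ≡⟨ G′.priority fv≈w ⟩
      G′.Ω w        ∎
      where open ≡-Reasoning

    -- On a uniform side, the answer to the opponent's move is bisimilar to the successor given
    -- there. If neither side is uniform, the preserved quotient owners are the actual owners, which
    -- therefore agree.
    related-owner : ∀ {v w v′ w′} → to v G′.≈ w → G.𝓟 v ≢ G′.𝓟 w →
                    v G.⟶ v′ → w G′.⟶ w′ → to v′ G′.≈ w′
    related-owner {v} {w} fv≈w v≢w i j with G.Uniform? v | G′.Uniform? w
    ... | yes uni | _ =
      let v″ , i″ , fv″≈w′ = back fv≈w j in G′.≈.trans (to-cong (uni i i″)) fv″≈w′
    ... | no _ | yes uni =
      let w″ , j″ , fv′≈w″ = forth fv≈w i in G′.≈.trans fv′≈w″ (uni j″ j)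
    ... | no ¬uni | no ¬uni′ = contradiction 𝓟v≡𝓟w v≢w
      where
      open ≡-Reasoning
      𝓟v≡𝓟w : G.𝓟 v ≡ G′.𝓟 w
      𝓟v≡𝓟w = begin
        G.𝓟 v         ≡⟨ G.¬Uniform⇒𝓟-q≡𝓟 ¬uni ⟨
        G.𝓟-q v       ≡⟨ 𝓟-preserved v ⟩
        G′.𝓟-q (to v) ≡⟨ GameStructure.𝓟-cong (quotient G′) fv≈w ⟩
        G′.𝓟-q w      ≡⟨ G′.¬Uniform⇒𝓟-q≡𝓟 ¬uni′ ⟩
        G′.𝓟 w        ∎

    -- Truncating with True brings the relation down to the level 0ℓ at which
    -- GovernedBisimilar quantifies.
    data Related : Rel ⊎.V 0ℓ where
      rel₁₂ : ∀ {v w} → True (to v G′.≈? w) → Related (inj₁ v) (inj₂ w)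
      rel₂₁ : ∀ {v w} → True (to v G′.≈? w) → Related (inj₂ w) (inj₁ v)

    Related-isBisimulation : IsGovernedBisimulation (G ⊎ᴳ G′) Related
    Related-isBisimulation = record
      { symmetric = λ where
          (rel₁₂ p) → rel₂₁ p
          (rel₂₁ p) → rel₁₂ p
      ; priority = λ where
          (rel₁₂ p) → related-priority (toWitness p)
          (rel₂₁ p) → sym (related-priority (toWitness p))
      ; owner = λ where
          (rel₁₂ p) v≢w _ _ (inj₁ i) (inj₂ j) → rel₁₂ (fromWitness (related-owner (toWitness p) v≢w i j))
          (rel₂₁ p) w≢v _ _ (inj₂ j) (inj₁ i) →
            rel₂₁ (fromWitness (related-owner (toWitness p) (w≢v ∘ sym) i j))
      ; transfer = λ where
          (rel₁₂ p) _ (inj₁ i) → let w′ , j , q = forth (toWitness p) i in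
            inj₂ w′ , inj₂ j , rel₁₂ (fromWitness q)
          (rel₂₁ p) _ (inj₂ j) → let v′ , i , q = back (toWitness p) j in
            inj₁ v′ , inj₁ i , rel₂₁ (fromWitness q)
      }

    Isomorphism⇒≈ᴳ : G ≈ᴳ G′
    Isomorphism⇒≈ᴳ =
        (λ v → to v , related G′.≈.refl)
      , (λ w → let v , fv≈w = surjective w in v , related (fv≈w G.≈.refl))
      where
      related : ∀ {v w} → to v G′.≈ w → inj₁ v ⊎.≈ inj₂ w
      related p = Related , Related-isBisimulation , rel₁₂ (fromWitness p)

theorem15 : (G G′ : ParityGame) →
    (G ≈ᴳ G′) ⇔ Isomorphism (quotient G) (quotient G′)
theorem15 G G′ = mk⇔ (≈ᴳ⇒Isomorphism G G′) (Isomorphism⇒≈ᴳ G G′)
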